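{- Let $S : \mathsf{Type}$, $\mathbf{P} : Ind \to S \to \mathsf{Type}$, $Q : S \to \mathsf{Type}$, and fix $\mathbf{X} : Ind \to \mathsf{Type}$. Let $G : \mathsf{Type}\to\mathsf{Type}$ be the functor $G\,Y = \sum_{s:S}\big(((ind:Ind) \to \mathbf{P}\,ind\,s \to \mathbf{X}\,ind) \times (Q\,s \to Y)\big)$. Then the type $$T_\nu = \sum_{m : \mathsf{M}\,S\,Q}\big((ind : Ind) \to \mathsf{Pos}\,\mathsf{MAlg}\,ind\,m \to \mathbf{X}\,ind\big)$$ carries a $G$-coalgebra structure $\mathsf{out} : T_\nu \to G\,T_\nu$ such that $(T_\nu,\mathsf{out})$ is a terminal $G$-coalgebra: for every $G$-coalgebra $(Y,\beta)$ the type of coalgebra morphisms $(Y,\beta)\to(T_\nu,\mathsf{out})$ is contractible. Concretely, $\mathsf{out}(m,k) = \big(\mathsf{shape}\,m,\ \lambda\,ind\,p.\,k\,ind\,(\mathsf{here}\,p),\ \lambda q.\,(\mathsf{pos}\,m\,q,\ \lambda\,ind\,p.\,k\,ind\,(\mathsf{below}\,q\,p))\big)$.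
   Context: Work in intensional type theory (Cubical Agda) with function extensionality and without assuming UIP; $\mathsf{Type}$ is regarded as a wild category. $\mathsf{M}\,S\,Q$ is the coinductive record type with fields $\mathsf{shape} : \mathsf{M}\,S\,Q \to S$ and $\mathsf{pos} : (m : \mathsf{M}\,S\,Q) \to Q(\mathsf{shape}\,m) \to \mathsf{M}\,S\,Q$. $\mathsf{MAlg}$ is the fixed point of $\llbracket S\triangleleft Q\rrbracket X=\sum_{s:S}(Q\,s\to X)$ with carrier $\mathsf{M}\,S\,Q$ whose inverse structure map $\xi$ has components $\xi_0\,m = \mathsf{shape}\,m$, $\xi_1\,m = \mathsf{pos}\,m$. For $ind : Ind$, $\mathsf{Pos}\,\mathsf{MAlg}\,ind : \mathsf{M}\,S\,Q \to \mathsf{Type}$ is the (inductive) family with constructors $\mathsf{here} : \mathbf{P}\,ind\,(\mathsf{shape}\,m) \to \mathsf{Pos}\,\mathsf{MAlg}\,ind\,m$ and $\mathsf{below} : (q : Q(\mathsf{shape}\,m)) \to \mathsf{Pos}\,\mathsf{MAlg}\,ind\,(\mathsf{pos}\,m\,q) \to \mathsf{Pos}\,\mathsf{MAlg}\,ind\,m$. A $G$-coalgebra is a pair $(Y,\beta : Y \to G\,Y)$; a coalgebra morphism $(Y,\beta)\to(Z,\gamma)$ is a function $f : Y\to Z$ with a path $\gamma\circ f = G\,f\circ\beta$, where $G\,f$ post-composes the $Y$-component with $f$. A coalgebra is terminal if all types of morphisms into it are contractible. -}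

{-# OPTIONS --without-K #-}
module Defs where

open import Data.Product using (Σ; Σ-syntax; _×_; _,_)
open import Function using (_∘_)
open import Level using (Level; suc)
open import Relation.Binary.PropositionalEquality using (_≡_; subst)

private
  variable
    ℓ : Level

isContr : Set ℓ → Set ℓ
isContr A = Σ[ x ∈ A ] ((y : A) → x ≡ y)

record M (S : Set ℓ) (Q : S → Set ℓ) : Set ℓ where
  coinductive
  field
    shape : S
    pos   : Q shape → M S Q

open M public

-- The next two types are the principles that make the record M coinductive.
-- Both are provable in Cubical Agda by guarded corecursion (the equations of
-- Corecursion then hold definitionally) but in Agda without --guardedness
-- and --cubical neither is derivable.

Corecursion : (S : Set ℓ) (Q : S → Set ℓ) → Set (suc ℓ)
Corecursion {ℓ} S Q =
  (Y : Set ℓ) (s : Y → S) (t : (y : Y) → Q (s y) → Y) →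
  Σ[ u ∈ (Y → M S Q) ]
    ((y : Y) → Σ[ e ∈ shape (u y) ≡ s y ]
      ((q : Q (shape (u y))) → pos (u y) q ≡ u (t y (subst Q e q))))

IsBisimulation : {S : Set ℓ} {Q : S → Set ℓ} → (M S Q → M S Q → Set ℓ) → Set ℓ
IsBisimulation {S = S} {Q} R =
  (m m′ : M S Q) → R m m′ →
  Σ[ e ∈ shape m ≡ shape m′ ]
    ((q : Q (shape m)) → R (pos m q) (pos m′ (subst Q e q)))

Coinduction : (S : Set ℓ) (Q : S → Set ℓ) → Set (suc ℓ)
Coinduction {ℓ} S Q =
  (R : M S Q → M S Q → Set ℓ) → IsBisimulation R →
  (m m′ : M S Q) → R m m′ → m ≡ m′

data Pos {Ind S : Set ℓ} (P : Ind → S → Set ℓ) (Q : S → Set ℓ) (ind : Ind) :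
         M S Q → Set ℓ where
  here  : {m : M S Q} → P ind (shape m) → Pos P Q ind m
  below : {m : M S Q} (q : Q (shape m)) → Pos P Q ind (pos m q) → Pos P Q ind m

module _ {Ind S : Set ℓ} (P : Ind → S → Set ℓ) (Q : S → Set ℓ) (X : Ind → Set ℓ) where

  G : Set ℓ → Set ℓ
  G Y = Σ[ s ∈ S ] (((ind : Ind) → P ind s → X ind) × (Q s → Y))

  G-map : {Y Z : Set ℓ} → (Y → Z) → G Y → G Z
  G-map f (s , g , h) = s , g , f ∘ h

  Coalgebra : Set (suc ℓ)
  Coalgebra = Σ[ Y ∈ Set ℓ ] (Y → G Y)

  CoalgebraMorphism : Coalgebra → Coalgebra → Set ℓ
  CoalgebraMorphism (Y , β) (Z , γ) = Σ[ f ∈ (Y → Z) ] (γ ∘ f ≡ G-map f ∘ β)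

  IsTerminal : Coalgebra → Set (suc ℓ)
  IsTerminal C = (B : Coalgebra) → isContr (CoalgebraMorphism B C)

  Tν : Set ℓ
  Tν = Σ[ m ∈ M S Q ] ((ind : Ind) → Pos P Q ind m → X ind)

  out : Tν → G Tν
  out (m , k) =
    shape m ,
    (λ ind p → k ind (here p)) ,
    (λ q → pos m q , (λ ind p → k ind (below q p)))

{-# OPTIONS --safe #-}
{-# OPTIONS --without-K #-}
module Submission where

-- Corecursion and Coinduction give a weakly terminal coalgebra all of whose
-- endomorphisms are pointwise the identity, but say nothing about the paths
-- carried by morphisms.  To gain this coherence, compare such a coalgebra T with
-- the limit Lim of the chain 1 ← F 1 ← F (F 1) ← ⋯ for F Y = Σ s (Q s → Y).
-- Maps Y → Lim compatible with a coalgebra structure on Y form a contractible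
-- type, being sequences each entry of which is determined by the previous one.
-- Lim is itself a coalgebra, so there are morphisms T → Lim → T, whose
-- composite is the identity; hence the type of morphisms Y → T is a retract of
-- a contractible type.  This is applied first to M, and then to Tν: an
-- endomorphism of Tν lies over the identity of M, together with its path, by the
-- terminality of M, and is then the identity on labels by induction on Pos.

open import Defs
open import Axiom.Extensionality.Propositional using (Extensionality; lower-extensionality)
open import Data.Nat using (ℕ; zero; suc)
open import Data.Product using (Σ; Σ-syntax; _×_; _,_; proj₁; proj₂)
open import Data.Unit.Polymorphic using (⊤; tt)
open import Function using (_∘_)
open import Level using (Level; 0ℓ)
open import Relation.Binary.PropositionalEquality using (_≡_; refl; sym; trans; cong; subst; subst₂)
open import Relation.Binary.PropositionalEquality.Properties using (trans-symˡ)

private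
  variable
    a b ℓ : Level

-- Contractible types

isContr⇒isProp : {A : Set a} → isContr A → (x y : A) → x ≡ y
isContr⇒isProp (_ , c) x y = trans (sym (c x)) (c y)

singleton-isContr : {A : Set a} (x : A) → isContr (Σ[ y ∈ A ] x ≡ y)
singleton-isContr x = (x , refl) , λ { (_ , refl) → refl }

Σ-isContr : {A : Set a} {B : A → Set b} →
  isContr A → (∀ x → isContr (B x)) → isContr (Σ A B)
Σ-isContr {A = A} {B} (x₀ , c) d = (x₀ , proj₁ (d x₀)) , λ (x , y) → lemma (c x) y
  where
  lemma : ∀ {x} → x₀ ≡ x → (y : B x) → (x₀ , proj₁ (d x₀)) ≡ (x , y)
  lemma refl y = cong (x₀ ,_) (proj₂ (d x₀) y)

-- Function extensionality

Π-singleton-isContr : Extensionality a b → {A : Set a} {B : A → Set b} (f : ∀ x → B x) →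
  isContr (Σ[ g ∈ (∀ x → B x) ] (∀ x → f x ≡ g x))
Π-singleton-isContr ext {B = B} f = (f , λ _ → refl) , λ (g , h) →
  cong (λ k → proj₁ ∘ k , proj₂ ∘ k)
    (ext {B = λ x → Σ[ y ∈ B x ] f x ≡ y} {f = λ x → f x , refl} {g = λ x → g x , h x}
      (λ x → proj₂ (singleton-isContr (f x)) (g x , h x)))

-- Path induction for homotopies: all pairs `(g , h)` based at `f` are equal.
Π-J : ∀ {c} → Extensionality a b → {A : Set a} {B : A → Set b} {f : ∀ x → B x}
  (C : (g : ∀ x → B x) → (∀ x → f x ≡ g x) → Set c) → C f (λ _ → refl) →
  ∀ {g} (h : ∀ x → f x ≡ g x) → C g h
Π-J ext {f = f} C base {g} h =
  subst (λ (g , h) → C g h) (proj₂ (Π-singleton-isContr ext f) (g , h)) base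

-- Normalised so that it sends the constant homotopy refl to refl.
ext-normalised : Extensionality a b → Extensionality a b
ext-normalised ext h = trans (sym (ext (λ _ → refl))) (ext h)

ext-normalised-refl : (ext : Extensionality a b) {A : Set a} {B : A → Set b} {f : ∀ x → B x} →
  ext-normalised ext {f = f} (λ _ → refl) ≡ refl
ext-normalised-refl ext = trans-symˡ (ext (λ _ → refl))

-- Sequences each entry of which is determined by the previous one

module _ (ext : Extensionality 0ℓ ℓ) {A : ℕ → Set ℓ} (E₀ : A 0 → Set ℓ)
  (E : ∀ n → A n → A (suc n) → Set ℓ) where

  DeterminedSequence : Set ℓ
  DeterminedSequence = Σ[ x ∈ (∀ n → A n) ] E₀ (x 0) × (∀ n → E n (x n) (x (suc n)))

  DeterminedSequence-≡ : ∀ {x e₀ e x′ e₀′ e′} (p : ∀ n → x n ≡ x′ n) →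
    subst E₀ (p 0) e₀ ≡ e₀′ →
    (∀ n → subst₂ (E n) (p n) (p (suc n)) (e n) ≡ e′ n) →
    _≡_ {A = DeterminedSequence} (x , e₀ , e) (x′ , e₀′ , e′)
  DeterminedSequence-≡ {x} {e₀} {e} p h₀ h = Π-J ext
    (λ x′ p → ∀ {e₀′ e′} → subst E₀ (p 0) e₀ ≡ e₀′ →
      (∀ n → subst₂ (E n) (p n) (p (suc n)) (e n) ≡ e′ n) →
      _≡_ {A = DeterminedSequence} (x , e₀ , e) (x′ , e₀′ , e′))
    (λ { refl h → cong (λ e′ → x , e₀ , e′) (ext h) })
    p h₀ h

  -- Both the centre and the paths to it arise by recursion: once the entries at `n` are identified,
  -- contractibility at `n` identifies the next entries and, over that path, the evidence linking
  -- them.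
  DeterminedSequence-isContr : isContr (Σ (A 0) E₀) →
    (∀ n y → isContr (Σ (A (suc n)) (E n y))) → isContr DeterminedSequence
  DeterminedSequence-isContr c₀ c = (x , proj₂ (proj₁ c₀) , e) , unique
    where
    x : ∀ n → A n
    x zero    = proj₁ (proj₁ c₀)
    x (suc n) = proj₁ (proj₁ (c n (x n)))

    e : ∀ n → E n (x n) (x (suc n))
    e n = proj₂ (proj₁ (c n (x n)))

    start : ∀ {y} → proj₁ c₀ ≡ y →
      Σ[ p ∈ x 0 ≡ proj₁ y ] subst E₀ p (proj₂ (proj₁ c₀)) ≡ proj₂ y
    start refl = refl , refl

    step : ∀ n {y z} (p : y ≡ z) (w : Σ (A (suc n)) (E n z)) →
      Σ[ q ∈ proj₁ (proj₁ (c n y)) ≡ proj₁ w ]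
        subst₂ (E n) p q (proj₂ (proj₁ (c n y))) ≡ proj₂ w
    step n {y} refl w = lemma (proj₂ (c n y) w)
      where
      lemma : ∀ {w} → proj₁ (c n y) ≡ w →
        Σ[ q ∈ proj₁ (proj₁ (c n y)) ≡ proj₁ w ]
          subst₂ (E n) refl q (proj₂ (proj₁ (c n y))) ≡ proj₂ w
      lemma refl = refl , refl

    unique : ∀ s → (x , proj₂ (proj₁ c₀) , e) ≡ s
    unique (x′ , e₀′ , e′) = DeterminedSequence-≡ p
      (proj₂ (start (proj₂ c₀ (x′ 0 , e₀′))))
      (λ n → proj₂ (step n (p n) (x′ (suc n) , e′ n)))
      where
      p : ∀ n → x n ≡ x′ n
      p zero    = proj₁ (start (proj₂ c₀ (x′ 0 , e₀′)))
      p (suc n) = proj₁ (step n (p n) (x′ (suc n) , e′ n))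

-- Coalgebras of the functor Σ s (Q s → _)

module Container (ext : Extensionality ℓ ℓ) (S : Set ℓ) (Q : S → Set ℓ) where

  extℕ : Extensionality 0ℓ ℓ
  extℕ = lower-extensionality ℓ 0ℓ ext

  F : Set ℓ → Set ℓ
  F Y = Σ[ s ∈ S ] (Q s → Y)

  F-map : {Y Z : Set ℓ} → (Y → Z) → F Y → F Z
  F-map f (s , t) = s , f ∘ t

  Morphism : {Y Z : Set ℓ} → (Y → F Y) → (Z → F Z) → Set ℓ
  Morphism {Y} {Z} β γ = Σ[ f ∈ (Y → Z) ] (∀ y → γ (f y) ≡ F-map f (β y))

  F-≡ : {Z : Set ℓ} {s s′ : S} {t : Q s → Z} {t′ : Q s′ → Z} (e : s ≡ s′) →
    (∀ q → t q ≡ t′ (subst Q e q)) → (s , t) ≡ (s′ , t′)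
  F-≡ {s = s} refl h = cong (s ,_) (ext h)

  F-≡⁻¹ : {Z : Set ℓ} {z z′ : F Z} (p : z ≡ z′) →
    ∀ q → proj₂ z q ≡ proj₂ z′ (subst Q (cong proj₁ p) q)
  F-≡⁻¹ refl q = refl

  -- The limit of the terminal chain as a coalgebra

  Approx : ℕ → Set ℓ
  Approx zero    = ⊤
  Approx (suc n) = F (Approx n)

  -- Expresses that the second argument truncates to the first, unfolded into a shape path and a
  -- pointwise condition on subtrees to avoid equations between functions.
  Compat : ∀ n → Approx n → Approx (suc n) → Set ℓ
  Compat zero    _       _         = ⊤
  Compat (suc n) (s , t) (s′ , t′) =
    Σ[ e ∈ s ≡ s′ ] (∀ q → Compat n (t q) (t′ (subst Q e q)))

  Lim : Set ℓ
  Lim = Σ[ x ∈ (∀ n → Approx n) ] (∀ n → Compat n (x n) (x (suc n)))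

  Lim⁺ : Set ℓ
  Lim⁺ = Σ[ x ∈ (∀ n → F (Approx n)) ] (∀ n → Compat (suc n) (x n) (x (suc n)))

  shift : Lim → Lim⁺
  shift (x , c) = x ∘ suc , c ∘ suc

  -- The root shapes of the levels agree only up to paths, so a position of the first is transported
  -- to each later one.
  track : ((x , _) : Lim⁺) → Q (proj₁ (x 0)) → ∀ n → Q (proj₁ (x n))
  track l       q zero    = q
  track (x , c) q (suc n) = subst Q (proj₁ (c n)) (track (x , c) q n)

  split : Lim⁺ → F Lim
  split (x , c) = proj₁ (x 0) , λ q →
    (λ n → proj₂ (x n) (track (x , c) q n)) ,
    (λ n → proj₂ (c n) (track (x , c) q n))

  glue : F Lim → Lim⁺
  glue (s , l) = (λ n → s , λ q → proj₁ (l q) n) , (λ n → refl , λ q → proj₂ (l q) n)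

  -- In glue (s , l) the tracked position is constant only up to a path for
  -- variable n, so it is contracted within the type of sequences with
  -- consecutive entries equal.
  split-glue : ∀ z → split (glue z) ≡ z
  split-glue (s , l) = cong (s ,_) (ext λ q →
    subst (λ (p , _ , r) → along p r ≡ l q)
      (isContr⇒isProp
        (DeterminedSequence-isContr extℕ (q ≡_) (λ _ → _≡_)
          (singleton-isContr q) (λ _ → singleton-isContr))
        ((λ _ → q) , refl , λ _ → refl)
        (track (glue (s , l)) q , refl , λ _ → refl))
      refl)
    where
    along : (p : ℕ → Q s) → (∀ n → p n ≡ p (suc n)) → Lim
    along p r =
      (λ n → proj₁ (l (p n)) n) ,
      (λ n → subst (λ q → Compat n (proj₁ (l (p n)) n) (proj₁ (l q) (suc n))) (r n)
               (proj₂ (l (p n)) n))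

  Pointwise : Lim⁺ → Lim⁺ → Set ℓ
  Pointwise (x , c) (x′ , c′) = Σ[ p ∈ (∀ n → x n ≡ x′ n) ]
    (∀ n → subst₂ (Compat (suc n)) (p n) (p (suc n)) (c n) ≡ c′ n)

  Pointwise⇒≡ : ∀ {l l′} → Pointwise l l′ → l ≡ l′
  Pointwise⇒≡ {x , c} (p , h) = Π-J extℕ
    (λ x′ p → ∀ {c′} → (∀ n → subst₂ (Compat (suc n)) (p n) (p (suc n)) (c n) ≡ c′ n) →
      (x , c) ≡ (x′ , c′))
    (λ h → cong (x ,_) (extℕ h))
    p h

  unfold : Lim → F Lim
  unfold = split ∘ shift

  glued⇒unfold : ∀ l z → Pointwise (glue z) (shift l) → unfold l ≡ z
  glued⇒unfold _ z h = trans (cong split (sym (Pointwise⇒≡ h))) (split-glue z)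

  -- Cones from a coalgebra to the limit

  module _ {Y : Set ℓ} (β : Y → F Y) where

    Approximation : Set ℓ
    Approximation = DeterminedSequence extℕ {A = λ n → Y → Approx n} (λ _ → ⊤)
      (λ n x x′ → ∀ y → F-map x (β y) ≡ x′ y)

    Compatibility : Approximation → Set ℓ
    Compatibility (x , _ , p) = DeterminedSequence extℕ
      {A = λ n → ∀ y → Compat n (x n y) (x (suc n) y)} (λ _ → ⊤)
      (λ n c c′ → ∀ y → subst₂ (Compat (suc n)) (p n y) (p (suc n) y)
                          (refl , λ q → c (proj₂ (β y) q)) ≡ c′ y)

    -- The maps h : Y → Lim with shift (h y) pointwise equal to glue (F-map h (β y)),
    -- rearranged so that contractibility can be read off.
    Cone : Set ℓ
    Cone = Σ Approximation Compatibility

    Cone-isContr : isContr Cone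
    Cone-isContr = Σ-isContr
      (DeterminedSequence-isContr extℕ _ _ (_ , λ _ → refl)
        (λ n x → Π-singleton-isContr ext (λ y → F-map x (β y))))
      (λ (_ , _ , p) → DeterminedSequence-isContr extℕ _ _ (_ , λ _ → refl)
        (λ n c → Π-singleton-isContr ext
          (λ y → subst₂ (Compat (suc n)) (p n y) (p (suc n) y)
                   (refl , λ q → c (proj₂ (β y) q)))))

    cone-map : Cone → Y → Lim
    cone-map ((x , _) , (c , _)) y = (λ n → x n y) , (λ n → c n y)

    cone-glued : ∀ k y → Pointwise (glue (F-map (cone-map k) (β y))) (shift (cone-map k y))
    cone-glued ((_ , _ , p) , (_ , _ , h)) y = (λ n → p n y) , (λ n → h n y)

  -- From weak terminality to terminality

  module _ {T : Set ℓ} (ξ : T → F T) where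

    truncate : ∀ n → T → Approx n
    truncate zero    _ = tt
    truncate (suc n) m = F-map (truncate n) (ξ m)

    truncate-compat : ∀ n m → Compat n (truncate n m) (truncate (suc n) m)
    truncate-compat zero    _ = tt
    truncate-compat (suc n) m = refl , λ q → truncate-compat n (proj₂ (ξ m) q)

    toLim : T → Lim
    toLim m = (λ n → truncate n m) , (λ n → truncate-compat n m)

    toLim-glued : ∀ {m z} → ξ m ≡ z → Pointwise (glue (F-map toLim z)) (shift (toLim m))
    toLim-glued refl = (λ _ → refl) , (λ _ → refl)

    toCone : {Y : Set ℓ} (β : Y → F Y) → Morphism β ξ → Cone β
    toCone β (f , φ) =
      ((λ n y → truncate n (f y)) , _ , λ n y → proj₁ (toLim-glued (φ y)) n) ,
      ((λ n y → truncate-compat n (f y)) , _ , λ n y → proj₂ (toLim-glued (φ y)) n)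

    -- Homotopy induction reduces `h` to the identity. Then `χ`, being defined on all paths out of
    -- `ξ m`, must be composition with the loop `χ refl`, which its inverse undoes.
    postcompose-injective : (h : T → T) → (∀ m → m ≡ h m) →
      (χ : ∀ {m z} → ξ m ≡ z → ξ (h m) ≡ F-map h z) →
      {Y : Set ℓ} (β : Y → F Y) ((f , φ) (g , ψ) : Morphism β ξ) →
      _≡_ {A = Morphism β ξ} (h ∘ f , λ y → χ (φ y)) (h ∘ g , λ y → χ (ψ y)) →
      _≡_ {A = Morphism β ξ} (f , φ) (g , ψ)
    postcompose-injective h id≡h = Π-J ext
      (λ h _ → (χ : ∀ {m z} → ξ m ≡ z → ξ (h m) ≡ F-map h z) →
        {Y : Set ℓ} (β : Y → F Y) ((f , φ) (g , ψ) : Morphism β ξ) →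
        _≡_ {A = Morphism β ξ} (h ∘ f , λ y → χ (φ y)) (h ∘ g , λ y → χ (ψ y)) →
        _≡_ {A = Morphism β ξ} (f , φ) (g , ψ))
      cancel id≡h
      where
      cancel : (χ : ∀ {m z} → ξ m ≡ z → ξ m ≡ z) →
        {Y : Set ℓ} (β : Y → F Y) ((f , φ) (g , ψ) : Morphism β ξ) →
        _≡_ {A = Morphism β ξ} (f , λ y → χ (φ y)) (g , λ y → χ (ψ y)) →
        _≡_ {A = Morphism β ξ} (f , φ) (g , ψ)
      cancel χ β k k′ eq = trans (sym (retraction k)) (trans (cong undo eq) (retraction k′))
        where
        undo : Morphism β ξ → Morphism β ξ
        undo (f , φ) = f , λ y → trans (sym (χ refl)) (φ y)

        undo-χ : ∀ {m z} (p : ξ m ≡ z) → trans (sym (χ refl)) (χ p) ≡ p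
        undo-χ refl = trans-symˡ (χ refl)

        retraction : ((f , φ) : Morphism β ξ) → undo (f , λ y → χ (φ y)) ≡ (f , φ)
        retraction (f , φ) = cong (f ,_) (ext λ y → undo-χ (φ y))

    weaklyTerminal⇒terminal :
      ({Y : Set ℓ} (β : Y → F Y) → Morphism β ξ) →
      (((f , _) : Morphism ξ ξ) → ∀ m → f m ≡ m) →
      {Y : Set ℓ} (β : Y → F Y) → isContr (Morphism β ξ)
    weaklyTerminal⇒terminal weak endo β = weak β , λ k →
      postcompose-injective (r ∘ toLim) (λ m → sym (endo (r ∘ toLim , λ _ → χ refl) m)) χ
        β (weak β) k
        -- `fromCone (toCone β k)` is definitionally `k` postcomposed with `r ∘ toLim`, path
        -- component included.
        (cong fromCone (isContr⇒isProp (Cone-isContr β) (toCone β (weak β)) (toCone β k)))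
      where
      r : Lim → T
      r = proj₁ (weak unfold)

      r-glued : ∀ l z → Pointwise (glue z) (shift l) → ξ (r l) ≡ F-map r z
      r-glued l z h = trans (proj₂ (weak unfold) l) (cong (F-map r) (glued⇒unfold l z h))

      χ : ∀ {m z} → ξ m ≡ z → ξ (r (toLim m)) ≡ F-map (r ∘ toLim) z
      χ {m} {z} p = r-glued (toLim m) (F-map toLim z) (toLim-glued p)

      fromCone : Cone β → Morphism β ξ
      fromCone k = r ∘ cone-map β k ,
        λ y → r-glued (cone-map β k y) (F-map (cone-map β k) (β y)) (cone-glued β k y)

-- Terminality of the unlabelled trees

module Trees (ext : Extensionality ℓ ℓ) {S : Set ℓ} (Q : S → Set ℓ)
  (corec : Corecursion S Q) (coind : Coinduction S Q) where

  open Container ext S Q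

  ξ : M S Q → F (M S Q)
  ξ m = shape m , pos m

  M-terminal : {Y : Set ℓ} (β : Y → F Y) → isContr (Morphism β ξ)
  M-terminal = weaklyTerminal⇒terminal ξ weak endo
    where
    weak : {Y : Set ℓ} (β : Y → F Y) → Morphism β ξ
    weak {Y} β with corec Y (proj₁ ∘ β) (proj₂ ∘ β)
    ... | u , eqs = u , λ y → F-≡ (proj₁ (eqs y)) (proj₂ (eqs y))

    endo : ((f , _) : Morphism ξ ξ) → ∀ m → f m ≡ m
    -- The graph of `f`, read backwards, is a bisimulation because `f` is a morphism.
    endo (f , φ) m = coind (λ m m′ → m ≡ f m′)
      (λ { _ m′ refl → cong proj₁ (φ m′) , F-≡⁻¹ (φ m′) }) (f m) m refl

-- Terminality of the labelled trees

module LabelledTrees (ext : Extensionality ℓ ℓ) {Ind S : Set ℓ}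
  (P : Ind → S → Set ℓ) (Q : S → Set ℓ)
  (corec : Corecursion S Q) (coind : Coinduction S Q) (X : Ind → Set ℓ) where

  -- Absorbing the root labels into the shape turns `G` into a functor of the form treated in
  -- `Container`.
  S⁺ : Set ℓ
  S⁺ = Σ[ s ∈ S ] ((ind : Ind) → P ind s → X ind)

  open module G⁺ = Container ext S⁺ (Q ∘ proj₁) using () renaming (F to F⁺; Morphism to Morphism⁺)
  open Container ext S Q using (F; Morphism; F-≡⁻¹)
  open Trees ext Q corec coind

  T : Set ℓ
  T = Tν P Q X

  assoc : {Y : Set ℓ} → G P Q X Y → F⁺ Y
  assoc (s , g , t) = (s , g) , t

  assoc⁻¹ : {Y : Set ℓ} → F⁺ Y → G P Q X Y
  assoc⁻¹ ((s , g) , t) = s , g , t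

  out⁺ : T → F⁺ T
  out⁺ = assoc ∘ out P Q X

  weak⁺ : {Y : Set ℓ} (β : Y → F⁺ Y) → Morphism⁺ β out⁺
  weak⁺ {Y} β = f , λ y → assemble (proj₁ (eqs y)) (proj₂ (eqs y))
    where
    s : Y → S
    s = proj₁ ∘ proj₁ ∘ β

    t : ∀ y → Q (s y) → Y
    t = proj₂ ∘ β

    u : Y → M S Q
    u = proj₁ (corec Y s t)

    Unfolds : M S Q → Y → Set ℓ
    Unfolds m y = Σ[ e ∈ shape m ≡ s y ] (∀ q → pos m q ≡ u (t y (subst Q e q)))

    eqs : ∀ y → Unfolds (u y) y
    eqs = proj₂ (corec Y s t)

    unfolds : ∀ {m} y → m ≡ u y → Unfolds m y
    unfolds y refl = eqs y

    -- Subtrees of `u y` are values of `u` only up to a path, so the recursion on positions lets `m`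
    -- vary and carries that path along.
    label : ∀ {ind m} → Pos P Q ind m → ∀ y → m ≡ u y → X ind
    label {ind} (here p) y eq =
      proj₂ (proj₁ (β y)) ind (subst (P ind) (proj₁ (unfolds y eq)) p)
    label (below q p) y eq =
      label p (t y (subst Q (proj₁ (unfolds y eq)) q)) (proj₂ (unfolds y eq) q)

    f : Y → T
    f y = u y , λ ind p → label p y refl

    label-≡ : ∀ {m} y (eq : m ≡ u y) → (m , λ ind p → label p y eq) ≡ f y
    label-≡ y refl = refl

    assemble : ∀ {s₀ s₁ g} {t₀ : Q s₀ → M S Q} {t₁ : Q s₁ → Y} (e : s₀ ≡ s₁)
      (h : ∀ q → t₀ q ≡ u (t₁ (subst Q e q))) →
      _≡_ {A = F⁺ T}
        ((s₀ , λ ind p → g ind (subst (P ind) e p)) ,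
          λ q → t₀ q , λ ind p → label p (t₁ (subst Q e q)) (h q))
        ((s₁ , g) , f ∘ t₁)
    assemble {s₀} {g = g} refl h = cong ((s₀ , g) ,_) (ext λ q → label-≡ _ (h q))

  forget : F⁺ T → F (M S Q)
  forget ((s , _) , t) = s , proj₁ ∘ t

  -- The path `π` is kept apart from `p` so that it can later be taken to be `refl`, which removes
  -- the transports.
  labels-agree : {z z′ : F⁺ T} (p : z ≡ z′) (π : forget z ≡ forget z′) → cong forget p ≡ π →
    (∀ ind x → proj₂ (proj₁ z) ind x ≡
      proj₂ (proj₁ z′) ind (subst (P ind) (cong proj₁ π) x)) ×
    (∀ ind q x → proj₂ (proj₂ z q) ind x ≡
      proj₂ (proj₂ z′ (subst Q (cong proj₁ π) q)) ind (subst (Pos P Q ind) (F-≡⁻¹ π q) x))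
  labels-agree refl _ refl = (λ _ _ → refl) , (λ _ _ _ → refl)

  tree-coalgebra : T → F T
  tree-coalgebra x = proj₁ (proj₁ (out⁺ x)) , proj₂ (out⁺ x)

  LabelsOver : Morphism tree-coalgebra ξ → Set ℓ
  LabelsOver (a , ψ) = Σ[ k ∈ (∀ x ind → Pos P Q ind (a x) → X ind) ]
    (∀ x → Σ[ p ∈ out⁺ (a x , k x) ≡ G⁺.F-map (λ y → a y , k y) (out⁺ x) ] cong forget p ≡ ψ x)

  -- With `h` free, path induction replaces it by the strict projection; the labels then agree by
  -- induction on positions.
  labelsOver-unique : ∀ {h} → (proj₁ , λ _ → refl) ≡ h → ((k , _) : LabelsOver h) →
    ∀ x → (proj₁ h x , k x) ≡ x
  labelsOver-unique refl (k , lifts) x = cong (proj₁ x ,_) (ext λ ind → ext (agree x ind))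
    where
    agree : ∀ x ind p → k x ind p ≡ proj₂ x ind p
    agree x ind (here p) =
      proj₁ (labels-agree (proj₁ (lifts x)) refl (proj₂ (lifts x))) ind p
    agree x ind (below q p) = trans
      (proj₂ (labels-agree (proj₁ (lifts x)) refl (proj₂ (lifts x))) ind q p)
      (agree (proj₂ (out⁺ x) q) ind p)

  endo⁺ : ((f , _) : Morphism⁺ out⁺ out⁺) → ∀ x → f x ≡ x
  endo⁺ (f , φ) = labelsOver-unique
    (isContr⇒isProp (M-terminal tree-coalgebra)
      (proj₁ , λ _ → refl) (proj₁ ∘ f , λ x → cong forget (φ x)))
    (proj₂ ∘ f , λ x → φ x , refl)

  out⁺-terminal : {Y : Set ℓ} (β : Y → F⁺ Y) → isContr (Morphism⁺ β out⁺)
  out⁺-terminal = G⁺.weaklyTerminal⇒terminal out⁺ weak⁺ endo⁺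

  terminal : IsTerminal P Q X (T , out P Q X)
  terminal (Y , β) = fromPointwise (proj₁ contr) , λ k →
    trans (cong fromPointwise (proj₂ contr (toPointwise k))) (retraction k)
    where
    contr : isContr (Morphism⁺ (assoc ∘ β) out⁺)
    contr = out⁺-terminal (assoc ∘ β)

    toPointwise : CoalgebraMorphism P Q X (Y , β) (T , out P Q X) → Morphism⁺ (assoc ∘ β) out⁺
    toPointwise (f , φ) = f , λ y → cong (λ h → assoc (h y)) φ

    fromPointwise : Morphism⁺ (assoc ∘ β) out⁺ → CoalgebraMorphism P Q X (Y , β) (T , out P Q X)
    fromPointwise (f , φ) = f , ext-normalised ext (λ y → cong assoc⁻¹ (φ y))

    normalise : {h h′ : Y → G P Q X T} (p : h ≡ h′) →
      ext-normalised ext (λ y → cong assoc⁻¹ (cong (λ h → assoc (h y)) p)) ≡ p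
    normalise refl = ext-normalised-refl ext

    -- Morphisms with a path of functions are thus a retract of those with pointwise paths, and
    -- inherit contractibility.
    retraction : ∀ k → fromPointwise (toPointwise k) ≡ k
    retraction (f , φ) = cong (f ,_) (normalise φ)

mainTheorem3 : {ℓ : Level} → Extensionality ℓ ℓ →
    {Ind S : Set ℓ} (P : Ind → S → Set ℓ) (Q : S → Set ℓ) →
    Corecursion S Q → Coinduction S Q →
    (X : Ind → Set ℓ) →
    IsTerminal P Q X (Tν P Q X , out P Q X)
mainTheorem3 ext P Q corec coind X = LabelledTrees.terminal ext P Q corec coind X
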